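{- Let $\mathcal{A}\subset\mathbb{R}^n$ be a non-empty finite set and let $X=\operatorname{pos}\{v^{(1)},\ldots,v^{(k)}\}\subset\mathbb{R}^n$ be an $n$-dimensional polyhedral cone spanned by the vectors $v^{(1)},\ldots,v^{(k)}$, where $k\ge n$. Then $$\{\lambda\in\Lambda_X^\star(\mathcal{A}) : \mathcal{A}\lambda=\mathbf{0}\}=\Lambda_{\mathbb{R}^n}^\star(\mathcal{A}).$$
   Context: $\operatorname{pos}$ denotes the set of all non-negative linear combinations. $\mathbb{R}^{\mathcal{A}}$ is the set of real vectors indexed by $\mathcal{A}$. For $\beta\in\mathcal{A}$, $N_\beta=\{\nu\in\mathbb{R}^{\mathcal{A}} : \nu_\alpha\ge 0 \text{ for all }\alpha\in\mathcal{A}\setminus\{\beta\},\ \sum_{\alpha\in\mathcal{A}}\nu_\alpha=0\}$. For $\nu\in\mathbb{R}^{\mathcal{A}}$ write $\mathcal{A}\nu=\sum_{\alpha\in\mathcal{A}}\alpha\,\nu_\alpha\in\mathbb{R}^n$. For a non-empty convex set $X\subset\mathbb{R}^n$, $\sigma_X(y)=\sup\{y^Tx : x\in X\}$ is the support function. A non-zero vector $\nu^*\in N_\beta$ is an $X$-circuit (sublinear circuit of $\mathcal{A}$ with respect to $X$) if (i) $\sigma_X(-\mathcal{A}\nu^*)<\infty$, and (ii) whenever the map $\nu\mapsto\sigma_X(-\mathcal{A}\nu)$ is linear on a two-dimensional convex cone contained in $N_\beta$ (i.e. is finite there and coincides there with a linear function), $\nu^*$ is not in the relative interior of that cone. $\Lambda_X(\mathcal{A},\beta)$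 denotes the set of $X$-circuits $\lambda\in N_\beta$ with $\lambda_\beta=-1$ (normalized), and $\Lambda_X(\mathcal{A})=\bigcup_{\beta\in\mathcal{A}}\Lambda_X(\mathcal{A},\beta)$. The circuit graph is the convex cone $G_X(\mathcal{A})=\operatorname{cone}\left(\{(\lambda,\sigma_X(-\mathcal{A}\lambda)) : \lambda\in\Lambda_X(\mathcal{A})\}\cup\{(\mathbf{0},1)\}\right)\subset\mathbb{R}^{\mathcal{A}}\times\mathbb{R}$ (conic hull). An $X$-circuit $\nu$ is reduced if its extended form $(\nu,\sigma_X(-\mathcal{A}\nu))$ generates an extreme ray of $G_X(\mathcal{A})$. $\Lambda_X^\star(\mathcal{A})$ is the set of normalized reduced $X$-circuits; $\Lambda_{\mathbb{R}^n}^\star(\mathcal{A})$ is the same with $X$ replaced by $\mathbb{R}^n$. -}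

module Defs where

open import Level using (Level; 0ℓ; suc; _⊔_)
open import Data.Nat.Base using (ℕ)
open import Data.Fin.Base using (Fin)
open import Data.Product.Base using (Σ; Σ-syntax; ∃; ∃-syntax; _×_; _,_)
open import Data.Vec.Functional using (Vector)
open import Algebra.Bundles using (CommutativeRing)
open import Algebra.Module.Bundles using (LeftModule)
open import Algebra.Module.Morphism.Structures using (IsLeftModuleHomomorphism)
open import Relation.Binary.Core using (Rel)
open import Relation.Binary.Definitions using (_Respects_)
open import Relation.Binary.Structures using (IsTotalOrder)
open import Relation.Binary.PropositionalEquality using (_≢_)
open import Relation.Nullary using (¬_)
open import Relation.Unary using (Pred; _⊆_; _≐_; _∪_)
import Algebra.Construct.Pointwise as Pointwise
import Algebra.Definitions.RawMonoid as RawMonoidDefs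
import Algebra.Module.Construct.DirectProduct as DirectProduct
import Algebra.Module.Construct.TensorUnit as TensorUnit
import Relation.Binary.Construct.NonStrictToStrict as NonStrictToStrict

module _ {a ℓ : Level} {A : Set a} (_≤_ : Rel A ℓ) where

  UpperBound : {p : Level} → Pred A p → Pred A (a ⊔ ℓ ⊔ p)
  UpperBound S b = ∀ x → S x → x ≤ b

  LeastUpperBound : {p : Level} → Pred A p → Pred A (a ⊔ ℓ ⊔ p)
  LeastUpperBound S s = UpperBound S s × (∀ b → UpperBound S b → s ≤ b)

-- The library has no real numbers.  They are axiomatised as a Dedekind-complete
-- ordered field, which determines ℝ up to isomorphism.  Under excluded middle a
-- model exists at level 0ℓ (Dedekind cuts ℚ → Bool), and every subset of a set
-- is then represented by a predicate at level 0ℓ, so quantifying over such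
-- predicates below is quantifying over all subsets.
record CompleteOrderedField : Set₁ where
  field
    commutativeRing : CommutativeRing 0ℓ 0ℓ

  open CommutativeRing commutativeRing public

  infix 4 _≤_

  field
    _≤_          : Rel Carrier 0ℓ
    isTotalOrder : IsTotalOrder _≈_ _≤_
    0≉1          : 0# ≉ 1#
    inverse      : ∀ x → x ≉ 0# → ∃[ y ] x * y ≈ 1#
    +-monoˡ-≤    : ∀ z {x y} → x ≤ y → x + z ≤ y + z
    *-nonNeg     : ∀ {x y} → 0# ≤ x → 0# ≤ y → 0# ≤ x * y
    complete     : (S : Pred Carrier 0ℓ) → ∃ S → ∃ (UpperBound _≤_ S) →
                   ∃ (LeastUpperBound _≤_ S)

  open NonStrictToStrict _≈_ _≤_ public using (_<_)

module SublinearCircuits (ℝ : CompleteOrderedField) where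

  open CompleteOrderedField ℝ
  open RawMonoidDefs +-rawMonoid using (sum)

  module Convexity (M : LeftModule ring 0ℓ 0ℓ) where
    open LeftModule M
    open RawMonoidDefs +ᴹ-rawMonoid using () renaming (sum to sumᴹ)

    lincomb : {k : ℕ} → Vector Carrier k → Vector Carrierᴹ k → Carrierᴹ
    lincomb c g = sumᴹ (λ i → c i *ₗ g i)

    Range : {k : ℕ} → Vector Carrierᴹ k → Pred Carrierᴹ 0ℓ
    Range v x = ∃[ i ] x ≈ᴹ v i

    LinearlyIndependent : {k : ℕ} → Pred (Vector Carrierᴹ k) 0ℓ
    LinearlyIndependent b = ∀ c → lincomb c b ≈ᴹ 0ᴹ → ∀ i → c i ≈ 0#

    -- With k = 0 this contains 0ᴹ, so pos of the empty set is {0}.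
    pos : {ℓ : Level} → Pred Carrierᴹ ℓ → Pred Carrierᴹ ℓ
    pos S x = ∃[ k ] Σ[ c ∈ Vector Carrier k ] Σ[ g ∈ Vector Carrierᴹ k ]
      (∀ i → 0# ≤ c i) × (∀ i → S (g i)) × x ≈ᴹ lincomb c g

    affineHull : {ℓ : Level} → Pred Carrierᴹ ℓ → Pred Carrierᴹ ℓ
    affineHull S x = ∃[ k ] Σ[ c ∈ Vector Carrier k ] Σ[ g ∈ Vector Carrierᴹ k ]
      sum c ≈ 1# × (∀ i → S (g i)) × x ≈ᴹ lincomb c g

    -- The affine hull is p + span b for linearly independent b₁, …, b_d.
    HasDimension : {ℓ : Level} → Pred Carrierᴹ ℓ → ℕ → Set ℓ
    HasDimension S d = Σ[ p ∈ Carrierᴹ ] Σ[ b ∈ Vector Carrierᴹ d ]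
      LinearlyIndependent b ×
      affineHull S ≐ (λ x → ∃[ t ] x ≈ᴹ p +ᴹ lincomb t b)

    record IsConvexCone {ℓ : Level} (C : Pred Carrierᴹ ℓ) : Set ℓ where
      field
        respects  : C Respects _≈ᴹ_
        0-mem     : C 0ᴹ
        +-closed  : ∀ {x y} → C x → C y → C (x +ᴹ y)
        *ₗ-closed : ∀ {t x} → 0# ≤ t → C x → C (t *ₗ x)

    IsConvex : {ℓ : Level} → Pred Carrierᴹ ℓ → Set ℓ
    IsConvex S = ∀ {x y t} → 0# ≤ t → t ≤ 1# → S x → S y →
      S (t *ₗ x +ᴹ (1# - t) *ₗ y)

    -- A face of a convex set: a convex subset containing both endpoints of
    -- each segment of the set that it meets in a relative interior point.
    record IsFace {ℓ₁ ℓ₂ : Level} (F : Pred Carrierᴹ ℓ₁) (S : Pred Carrierᴹ ℓ₂) :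
                  Set (ℓ₁ ⊔ ℓ₂) where
      field
        convex   : IsConvex F
        subset   : F ⊆ S
        extremal : ∀ {x y t} → S x → S y → 0# < t → t < 1# →
                   F (t *ₗ x +ᴹ (1# - t) *ₗ y) → F x × F y

    Ray : Carrierᴹ → Pred Carrierᴹ 0ℓ
    Ray g x = ∃[ t ] 0# ≤ t × x ≈ᴹ t *ₗ g

    GeneratesExtremeRay : {ℓ : Level} → Pred Carrierᴹ ℓ → Pred Carrierᴹ ℓ
    GeneratesExtremeRay S g = g ≉ᴹ 0ᴹ × IsFace (Ray g) S

  open Convexity public

  ℝ¹ : LeftModule ring 0ℓ 0ℓ
  ℝ¹ = TensorUnit.leftModule

  infix 9 ℝ^_

  ℝ^_ : ℕ → LeftModule ring 0ℓ 0ℓ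
  ℝ^ d = record
    { Carrierᴹ     = Vector Carrier d
    ; _≈ᴹ_         = λ x y → ∀ i → x i ≈ y i
    ; _+ᴹ_         = λ x y i → x i + y i
    ; _*ₗ_         = λ t x i → t * x i
    ; 0ᴹ           = λ _ → 0#
    ; -ᴹ_          = λ x i → - x i
    ; isLeftModule = record
      { isLeftSemimodule = record
        { +ᴹ-isCommutativeMonoid = Pointwise.isCommutativeMonoid (Fin d) +-isCommutativeMonoid
        ; isPreleftSemimodule = record
          { *ₗ-cong      = λ t≈u x≈y i → *-cong t≈u (x≈y i)
          ; *ₗ-zeroˡ     = λ x i → zeroˡ (x i)
          ; *ₗ-distribʳ  = λ x t u i → distribʳ (x i) t u
          ; *ₗ-identityˡ = λ x i → *-identityˡ (x i)
          ; *ₗ-assoc     = λ t u x i → *-assoc t u (x i)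
          ; *ₗ-zeroʳ     = λ t _ → zeroʳ t
          ; *ₗ-distribˡ  = λ t x y i → distribˡ t (x i) (y i)
          }
        }
      ; -ᴹ‿cong    = λ x≈y i → -‿cong (x≈y i)
      ; -ᴹ‿inverse = (λ x i → -‿inverseˡ (x i)) , (λ x i → -‿inverseʳ (x i))
      }
    }

  dot : {d : ℕ} → Vector Carrier d → Vector Carrier d → Carrier
  dot x y = sum (λ i → x i * y i)

  -- y lies in the open Euclidean ball of radius ε > 0 around x.
  Ball : {d : ℕ} → Vector Carrier d → Carrier → Pred (Vector Carrier d) 0ℓ
  Ball x ε y = dot (λ i → y i - x i) (λ i → y i - x i) < ε * ε

  relativeInterior : {d : ℕ} {ℓ : Level} → Pred (Vector Carrier d) ℓ → Pred (Vector Carrier d) ℓ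
  relativeInterior {d} S x = S x ×
    ∃[ ε ] 0# < ε × (∀ y → affineHull (ℝ^ d) S y → Ball x ε y → S y)

  -- σ X y s states σ_X(y) = s for a real number s; hence σ_X(y) < ∞, for
  -- non-empty X, is ∃ (σ X y).
  σ : {d : ℕ} → Pred (Vector Carrier d) 0ℓ → Vector Carrier d → Pred Carrier 0ℓ
  σ X y = LeastUpperBound _≤_ (λ r → ∃[ x ] X x × r ≈ dot y x)

  -- A finite set 𝒜 ⊂ ℝⁿ is given by an enumeration A of its m elements, so that
  -- ℝ^𝒜 becomes ℝ^ m and β ∈ 𝒜 becomes an index in Fin m; A · ν is 𝒜ν = Σ_α α ν_α.
  infixl 7 _·_

  _·_ : {n m : ℕ} → Vector (Vector Carrier n) m → Vector Carrier m → Vector Carrier n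
  _·_ {n} A ν = lincomb (ℝ^ n) ν A

  N : {m : ℕ} → Fin m → Pred (Vector Carrier m) 0ℓ
  N β ν = (∀ α → α ≢ β → 0# ≤ ν α) × sum ν ≈ 0#

  module _ {n m : ℕ} (X : Pred (Vector Carrier n) 0ℓ) (A : Vector (Vector Carrier n) m) where

    open LeftModule (ℝ^ n) using () renaming (-ᴹ_ to -ⁿ_)

    LinearOn : Pred (Vector Carrier m) 0ℓ → Set
    LinearOn C = Σ[ f ∈ (Vector Carrier m → Carrier) ]
      IsLeftModuleHomomorphism (LeftModule.rawLeftModule (ℝ^ m))
                               (LeftModule.rawLeftModule ℝ¹) f ×
      (∀ ν → C ν → σ X (-ⁿ (A · ν)) (f ν))

    record IsCircuit (β : Fin m) (ν : Vector Carrier m) : Set₁ where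
      open LeftModule (ℝ^ m) using (_≉ᴹ_; 0ᴹ)
      field
        nonzero    : ν ≉ᴹ 0ᴹ
        mem-N      : N β ν
        finite     : ∃ (σ X (-ⁿ (A · ν)))
        not-relint : (C : Pred (Vector Carrier m) 0ℓ) →
                     IsConvexCone (ℝ^ m) C → HasDimension (ℝ^ m) C 2 →
                     C ⊆ N β → LinearOn C → ¬ relativeInterior C ν

    Λ : Pred (Vector Carrier m) (suc 0ℓ)
    Λ ν = ∃[ β ] IsCircuit β ν × ν β ≈ - 1#

    ℝ^𝒜×ℝ : LeftModule ring 0ℓ 0ℓ
    ℝ^𝒜×ℝ = DirectProduct.leftModule (ℝ^ m) ℝ¹

    open LeftModule ℝ^𝒜×ℝ using (_≈ᴹ_) renaming (Carrierᴹ to Extended)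
    open LeftModule (ℝ^ m) using (0ᴹ)

    circuitGraph : Pred Extended (suc 0ℓ)
    circuitGraph = pos ℝ^𝒜×ℝ
      ((λ (ν , s) → Λ ν × σ X (-ⁿ (A · ν)) s) ∪ (λ p → p ≈ᴹ (0ᴹ , 1#)))

    IsReduced : Pred (Vector Carrier m) (suc 0ℓ)
    IsReduced ν = ∃[ s ] σ X (-ⁿ (A · ν)) s ×
      GeneratesExtremeRay ℝ^𝒜×ℝ circuitGraph (ν , s)

    Λ⋆ : Pred (Vector Carrier m) (suc 0ℓ)
    Λ⋆ ν = Λ ν × IsReduced ν

{-# OPTIONS --safe #-}

-- For a cone X, σ_X(−Aν) is 0 if Aν lies in the dual cone X* and +∞ otherwise.
-- As X is full-dimensional, X* is pointed, so {ν : Aν = 0} is a face of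
-- {ν : Aν ∈ X*}.  Hence the X-circuits with Aν = 0 are exactly the ℝⁿ-circuits,
-- and G_{ℝⁿ}(𝒜) is the face {Aν = 0} of G_X(𝒜): a ray inside this face is extreme
-- in one cone iff it is extreme in the other.
module Submission where

open import Defs
open import Level using (0ℓ; Lift; lift; lower) renaming (suc to ℓsuc)
open import Axiom.ExcludedMiddle using (ExcludedMiddle)
open import Algebra.Module.Bundles using (LeftModule)
open import Data.Empty using (⊥-elim)
open import Data.Fin.Base using (Fin; zero; suc; punchIn)
open import Data.Nat.Base using (ℕ; _≤_; NonZero; zero; suc)
open import Data.Product.Base using (Σ-syntax; ∃; ∃-syntax; _×_; _,_; proj₁; proj₂)
open import Data.Sum.Base using (inj₁; inj₂; [_,_]′)
open import Data.Vec.Functional using (Vector; []; _∷_; insertAt)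
open import Data.Vec.Functional.Properties using (insertAt-lookup; insertAt-punchIn)
open import Function.Base using (_∘_)
open import Function.Definitions using (Injective)
open import Relation.Binary.PropositionalEquality using (_≡_)
open import Relation.Binary.Structures using (IsTotalOrder)
open import Relation.Nullary using (¬_; Dec; yes; no)
open import Relation.Nullary.Decidable using (map′; decidable-stable)
open import Relation.Unary using (Pred; U; _∩_; _∪_; _≐_; _⊆_)
import Algebra.Properties.Group as GroupProperties
import Algebra.Properties.Ring as RingProperties
import Algebra.Properties.Semiring.Sum as SemiringSum
import Algebra.Solver.Ring.NaturalCoefficients.Default as SemiringSolver
import Relation.Binary.Reasoning.Setoid as SetoidReasoning

-- Ordered field arithmetic and finite sums.

module OrderedField (ℝ : CompleteOrderedField) where

  open CompleteOrderedField ℝ public renaming (_≤_ to _≤ʳ_; zero to *-zero)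
  open IsTotalOrder isTotalOrder public
    using (antisym; total; ≲-respˡ-≈; ≲-respʳ-≈)
    renaming (reflexive to ≤-reflexive; trans to ≤-trans; refl to ≤-refl)
  open RingProperties ring public using (-‿distribˡ-*; -‿distribʳ-*; -0#≈0#; -‿involutive)
  open GroupProperties +-group public using () renaming (x∙y⁻¹≈ε⇒x≈y to x-y≈0⇒x≈y)
  open SemiringSum semiring public
    using (sum; sum-cong-≋; sum-remove; ∑-distrib-+; *-distribˡ-sum; *-distribʳ-sum; sum-replicate-zero)

  module Solver = SemiringSolver commutativeSemiring

  0≤x⇒-x≤0 : ∀ {x} → 0# ≤ʳ x → - x ≤ʳ 0#
  0≤x⇒-x≤0 {x} p = ≲-respˡ-≈ (+-identityˡ _) (≲-respʳ-≈ (-‿inverseʳ x) (+-monoˡ-≤ (- x) p))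

  x≤0⇒0≤-x : ∀ {x} → x ≤ʳ 0# → 0# ≤ʳ - x
  x≤0⇒0≤-x {x} p = ≲-respˡ-≈ (-‿inverseʳ x) (≲-respʳ-≈ (+-identityˡ _) (+-monoˡ-≤ (- x) p))

  +-nonNeg : ∀ {x y} → 0# ≤ʳ x → 0# ≤ʳ y → 0# ≤ʳ x + y
  +-nonNeg {x} {y} p q = ≤-trans q (≲-respˡ-≈ (+-identityˡ y) (+-monoˡ-≤ y p))

  +-≈0⇒≈0 : ∀ {x y} → 0# ≤ʳ x → 0# ≤ʳ y → x + y ≈ 0# → x ≈ 0#
  +-≈0⇒≈0 {x} {y} p q e = antisym
    (≤-trans (≲-respʳ-≈ (+-comm y x) (≲-respˡ-≈ (+-identityˡ x) (+-monoˡ-≤ x q))) (≤-reflexive e)) p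

  +-≈0⇒≈0ʳ : ∀ {x y} → 0# ≤ʳ x → 0# ≤ʳ y → x + y ≈ 0# → y ≈ 0#
  +-≈0⇒≈0ʳ p q e = +-≈0⇒≈0 q p (trans (+-comm _ _) e)

  square-nonNeg : ∀ x → 0# ≤ʳ x * x
  square-nonNeg x = [ (λ p → *-nonNeg p p) , (λ p → ≲-respʳ-≈ neg² (*-nonNeg (x≤0⇒0≤-x p) (x≤0⇒0≤-x p))) ]′
    (total 0# x)
    where
    neg² : - x * - x ≈ x * x
    neg² = trans (sym (-‿distribˡ-* x (- x)))
      (trans (-‿cong (sym (-‿distribʳ-* x x))) (-‿involutive _))

  0≤1 : 0# ≤ʳ 1#
  0≤1 = ≲-respʳ-≈ (*-identityˡ 1#) (square-nonNeg 1#)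

  1≰0 : ¬ 1# ≤ʳ 0#
  1≰0 p = 0≉1 (antisym 0≤1 p)

  x≉0∧xy≈0⇒y≈0 : ∀ {x y} → x ≉ 0# → x * y ≈ 0# → y ≈ 0#
  x≉0∧xy≈0⇒y≈0 {x} {y} x≉0 xy≈0 with w , xw≈1 ← inverse x x≉0 = begin
    y           ≈⟨ *-identityʳ y ⟨
    y * 1#      ≈⟨ *-congˡ xw≈1 ⟨
    y * (x * w) ≈⟨ solve 3 (λ x y w → y :* (x :* w) := (x :* y) :* w) refl x y w ⟩
    x * y * w   ≈⟨ *-congʳ xy≈0 ⟩
    0# * w      ≈⟨ zeroˡ w ⟩
    0#          ∎
    where
    open SetoidReasoning setoid
    open Solver

  inverse-nonNeg : ∀ {x w} → 0# ≤ʳ x → x * w ≈ 1# → 0# ≤ʳ w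
  inverse-nonNeg {x} {w} 0≤x xw≈1 = ≲-respʳ-≈ w²x≈w (*-nonNeg (square-nonNeg w) 0≤x)
    where
    open SetoidReasoning setoid
    open Solver
    w²x≈w : w * w * x ≈ w
    w²x≈w = begin
      w * w * x   ≈⟨ solve 2 (λ x w → w :* w :* x := w :* (x :* w)) refl x w ⟩
      w * (x * w) ≈⟨ *-congˡ xw≈1 ⟩
      w * 1#      ≈⟨ *-identityʳ w ⟩
      w           ∎

  inverse-nonZero : ∀ {x w} → x * w ≈ 1# → w ≉ 0#
  inverse-nonZero {x} xw≈1 w≈0 = 0≉1 (trans (sym (zeroʳ x)) (trans (*-congˡ (sym w≈0)) xw≈1))

  1+x≉0 : ∀ {x} → 0# ≤ʳ x → 1# + x ≉ 0#
  1+x≉0 0≤x e = 0≉1 (sym (+-≈0⇒≈0 0≤1 0≤x e))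

  sum-zero : ∀ {d} {f : Vector Carrier d} → (∀ i → f i ≈ 0#) → sum f ≈ 0#
  sum-zero {d} f≈0 = trans (sum-cong-≋ f≈0) (sum-replicate-zero d)

  sum-nonNeg : ∀ {d} {f : Vector Carrier d} → (∀ i → 0# ≤ʳ f i) → 0# ≤ʳ sum f
  sum-nonNeg {zero}  p = ≤-refl
  sum-nonNeg {suc d} p = +-nonNeg (p zero) (sum-nonNeg (p ∘ suc))

  sum-≈0⇒≈0 : ∀ {d} {f : Vector Carrier d} → (∀ i → 0# ≤ʳ f i) → sum f ≈ 0# → ∀ i → f i ≈ 0#
  sum-≈0⇒≈0 p e zero    = +-≈0⇒≈0 (p zero) (sum-nonNeg (p ∘ suc)) e
  sum-≈0⇒≈0 p e (suc i) = sum-≈0⇒≈0 (p ∘ suc) (+-≈0⇒≈0ʳ (p zero) (sum-nonNeg (p ∘ suc)) e) i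

  0<x⇒x≉0 : ∀ {x} → 0# < x → x ≉ 0#
  0<x⇒x≉0 (_ , 0≉x) = 0≉x ∘ sym

  -- t = ε / (1 + D).
  small-scale : ∀ {ε D} → 0# < ε → 0# ≤ʳ D → ∃[ t ] 0# < t × t * t * D < ε * ε
  small-scale {ε} {D} 0<ε 0≤D with w , e ← inverse (1# + D) (1+x≉0 0≤D) =
    t , (0≤t , t≉0 ∘ sym) , ≲-respʳ-≈ (sym split) (≲-respˡ-≈ (+-identityˡ _) (+-monoˡ-≤ _ 0≤rest)) , strict
    where
    open SetoidReasoning setoid
    open Solver
    t = ε * w
    -- As t (1 + D) = ε, this splits (1 + D)² into itself plus D: ε² exceeds t² D by `rest`, which
    -- is non-zero because both t and this factor are.
    1+D+D² = 1# + (D + D * D)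
    rest = t * t * 1+D+D²
    0≤t : 0# ≤ʳ t
    0≤t = *-nonNeg (proj₁ 0<ε) (inverse-nonNeg (+-nonNeg 0≤1 0≤D) e)
    t≉0 : t ≉ 0#
    t≉0 t≈0 = inverse-nonZero e (x≉0∧xy≈0⇒y≈0 (0<x⇒x≉0 0<ε) t≈0)
    0≤D+D² : 0# ≤ʳ D + D * D
    0≤D+D² = +-nonNeg 0≤D (square-nonNeg D)
    0≤rest : 0# ≤ʳ rest
    0≤rest = *-nonNeg (square-nonNeg t) (+-nonNeg 0≤1 0≤D+D²)
    split : ε * ε ≈ rest + t * t * D
    split = begin
      ε * ε                                             ≈⟨ *-identityʳ _ ⟨
      ε * ε * 1#                                        ≈⟨ *-congˡ (*-identityʳ 1#) ⟨
      ε * ε * (1# * 1#)                                 ≈⟨ *-congˡ (*-cong e e) ⟨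
      ε * ε * ((1# + D) * w * ((1# + D) * w))
        ≈⟨ solve 3 (λ ε D w → ε :* ε :* ((con 1 :+ D) :* w :* ((con 1 :+ D) :* w)) :=
             (ε :* w) :* (ε :* w) :* (con 1 :+ (D :+ D :* D)) :+ (ε :* w) :* (ε :* w) :* D) refl ε D w ⟩
      rest + t * t * D                                  ∎
    strict : t * t * D ≉ ε * ε
    strict eq = 1+x≉0 0≤D+D² (x≉0∧xy≈0⇒y≈0 t≉0 (x≉0∧xy≈0⇒y≈0 t≉0
      (trans (sym (*-assoc t t 1+D+D²)) rest≈0)))
      where
      rest≈0 : rest ≈ 0#
      rest≈0 = begin
        rest                                  ≈⟨ +-identityʳ rest ⟨
        rest + 0#                             ≈⟨ +-congˡ (-‿inverseʳ _) ⟨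
        rest + (t * t * D - t * t * D)        ≈⟨ +-assoc _ _ _ ⟨
        rest + t * t * D - t * t * D          ≈⟨ +-congʳ (trans (sym split) (sym eq)) ⟩
        t * t * D - t * t * D                 ≈⟨ -‿inverseʳ _ ⟩
        0#                                    ∎

module ConeCircuits (em : ExcludedMiddle (ℓsuc 0ℓ)) (ℝ : CompleteOrderedField) where

  open OrderedField ℝ
  open SublinearCircuits ℝ

  dec : (P : Set) → Dec P
  dec P = map′ lower lift (em {Lift (ℓsuc 0ℓ) P})

  -- Linear functionals and the dot product.

  module _ (M : LeftModule ring 0ℓ 0ℓ) where
    open LeftModule M
    open import Algebra.Properties.CommutativeMonoid.Sum +ᴹ-commutativeMonoid
      using () renaming (sum-cong-≋ to sumᴹ-cong)

    record IsLinear (ψ : Carrierᴹ → Carrier) : Set where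
      field
        cong   : ∀ {x y} → x ≈ᴹ y → ψ x ≈ ψ y
        +-homo : ∀ x y → ψ (x +ᴹ y) ≈ ψ x + ψ y
        *-homo : ∀ t x → ψ (t *ₗ x) ≈ t * ψ x

      0-homo : ψ 0ᴹ ≈ 0#
      0-homo = trans (cong (≈ᴹ-sym (*ₗ-zeroˡ 0ᴹ))) (trans (*-homo 0# 0ᴹ) (zeroˡ _))

      -‿homo : ∀ x → ψ (-ᴹ x) ≈ - ψ x
      -‿homo x = inverseˡ-unique _ _
        (trans (sym (+-homo (-ᴹ x) x)) (trans (cong (-ᴹ‿inverseˡ x)) 0-homo))
        where
        open GroupProperties +-group using (inverseˡ-unique)

      lincomb-homo : ∀ {k} (c : Vector Carrier k) g →
        ψ (lincomb M c g) ≈ sum (λ i → c i * ψ (g i))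
      lincomb-homo {zero}  c g = 0-homo
      lincomb-homo {suc k} c g = trans (+-homo _ _)
        (+-cong (*-homo _ _) (lincomb-homo (c ∘ suc) (g ∘ suc)))

      lincomb-zero : ∀ {k} (c : Vector Carrier k) g → (∀ i → ψ (g i) ≈ 0#) → ψ (lincomb M c g) ≈ 0#
      lincomb-zero c g ψg≈0 = trans (lincomb-homo c g)
        (sum-zero (λ i → trans (*-congˡ (ψg≈0 i)) (zeroʳ (c i))))

    -- Only the scaled terms are compared, so `g` and `g′` may differ freely wherever the
    -- coefficient vanishes. The replacement of generators in `graph⇒graphU` relies on this.
    lincomb-cong : ∀ {k} {c c′ : Vector Carrier k} {g g′} →
      (∀ i → c i *ₗ g i ≈ᴹ c′ i *ₗ g′ i) → lincomb M c g ≈ᴹ lincomb M c′ g′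
    lincomb-cong = sumᴹ-cong

  open IsLinear

  -- Together with `lincomb-homo` this turns a coordinate of a linear combination of vectors into a
  -- sum of scalars.
  coordinate-linear : ∀ {d} (j : Fin d) → IsLinear (ℝ^ d) (λ x → x j)
  coordinate-linear j = record
    { cong = λ x≈y → x≈y j ; +-homo = λ _ _ → refl ; *-homo = λ _ _ → refl }

  dot-linear : ∀ {d} (w : Vector Carrier d) → IsLinear (ℝ^ d) (λ x → dot x w)
  dot-linear w = record
    { cong   = λ x≈y → sum-cong-≋ (λ i → *-congʳ (x≈y i))
    ; +-homo = λ x y → trans (sum-cong-≋ (λ i → distribʳ (w i) (x i) (y i)))
        (∑-distrib-+ (λ i → x i * w i) (λ i → y i * w i))
    ; *-homo = λ t x → trans (sum-cong-≋ (λ i → *-assoc t (x i) (w i)))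
        (sym (*-distribˡ-sum t (λ i → x i * w i)))
    }

  dot-comm : ∀ {d} (x y : Vector Carrier d) → dot x y ≈ dot y x
  dot-comm x y = sum-cong-≋ (λ i → *-comm (x i) (y i))

  dot-self-nonNeg : ∀ {d} (x : Vector Carrier d) → 0# ≤ʳ dot x x
  dot-self-nonNeg x = sum-nonNeg (λ i → square-nonNeg (x i))

  x*x≈0⇒x≈0 : ∀ {x} → x * x ≈ 0# → x ≈ 0#
  x*x≈0⇒x≈0 {x} e = decidable-stable (dec (x ≈ 0#)) (λ x≉0 → x≉0 (x≉0∧xy≈0⇒y≈0 x≉0 e))

  dot-self≈0⇒≈0 : ∀ {d} {x : Vector Carrier d} → dot x x ≈ 0# → ∀ i → x i ≈ 0#
  dot-self≈0⇒≈0 {x = x} e i = x*x≈0⇒x≈0 (sum-≈0⇒≈0 (λ j → square-nonNeg (x j)) e i)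

  -- Linear dependence and orthogonality to a full-dimensional set.

  NonTrivialRelation : ∀ {d k} → Vector (Vector Carrier d) k → Set
  NonTrivialRelation {d} {k} g = Σ[ c ∈ Vector Carrier k ]
    (∃[ i ] c i ≉ 0#) × (∀ j → sum (λ i → c i * g i j) ≈ 0#)

  -- Gaussian elimination; cross-multiplying with the pivot avoids dividing by it.
  eliminate : ∀ {d k} (g : Vector (Vector Carrier (suc d)) (suc k)) (i : Fin (suc k)) → g i zero ≉ 0# →
    NonTrivialRelation (λ l j → g i zero * g (punchIn i l) (suc j) + - g (punchIn i l) zero * g i (suc j)) →
    NonTrivialRelation g
  eliminate {d} {k} g i p≉0 (e , (l , el≉0) , rel) = c , (punchIn i l , c≉0) , relation
    where
    open SetoidReasoning setoid
    open Solver
    p : Carrier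
    p = g i zero
    h : Vector (Vector Carrier (suc d)) k
    h l = g (punchIn i l)
    -- The relation e among the reduced vectors p h_l - (h_l)₀ g_i is regrouped by original vectors:
    -- h_l receives p e_l, and the multiples of the pivot vector g_i add up to `cᵢ`.
    cᵢ : Carrier
    cᵢ = sum (λ l → e l * - h l zero)
    c : Vector Carrier (suc k)
    c = insertAt (λ l → p * e l) i cᵢ
    c≉0 : c (punchIn i l) ≉ 0#
    c≉0 c≈0 = el≉0 (x≉0∧xy≈0⇒y≈0 p≉0 (trans (sym (reflexive (insertAt-punchIn _ i cᵢ l))) c≈0))
    expand : ∀ j → sum (λ i → c i * g i j) ≈ sum (λ l → e l * (p * h l j + - h l zero * g i j))
    expand j = begin
      sum (λ i → c i * g i j)
        ≈⟨ sum-remove {i = i} (λ i → c i * g i j) ⟩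
      c i * g i j + sum (λ l → c (punchIn i l) * h l j)
        ≈⟨ +-cong (*-congʳ (reflexive (insertAt-lookup _ i cᵢ)))
             (sum-cong-≋ (λ l → *-congʳ (reflexive (insertAt-punchIn _ i cᵢ l)))) ⟩
      cᵢ * g i j + sum (λ l → p * e l * h l j)
        ≈⟨ +-congʳ (*-distribʳ-sum (g i j) (λ l → e l * - h l zero)) ⟩
      sum (λ l → e l * - h l zero * g i j) + sum (λ l → p * e l * h l j)
        ≈⟨ ∑-distrib-+ (λ l → e l * - h l zero * g i j) (λ l → p * e l * h l j) ⟨
      sum (λ l → e l * - h l zero * g i j + p * e l * h l j)
        ≈⟨ sum-cong-≋ (λ l → solve 5 (λ e m q p x → e :* m :* q :+ p :* e :* x := e :* (p :* x :+ m :* q))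
             refl (e l) (- h l zero) (g i j) p (h l j)) ⟩
      sum (λ l → e l * (p * h l j + - h l zero * g i j)) ∎
    relation : ∀ j → sum (λ i → c i * g i j) ≈ 0#
    -- The reduced vectors omit coordinate 0, so `rel` says nothing about it; there each summand
    -- cancels by the choice of multiplier.
    relation zero = trans (expand zero) (sum-zero (λ l → trans (*-congˡ (pivot-row l)) (zeroʳ (e l))))
      where
      pivot-row : ∀ l → p * h l zero + - h l zero * p ≈ 0#
      pivot-row l = begin
        p * h l zero + - h l zero * p ≈⟨ +-congˡ (*-comm _ _) ⟩
        p * h l zero + p * - h l zero ≈⟨ distribˡ p _ _ ⟨
        p * (h l zero - h l zero)     ≈⟨ *-congˡ (-‿inverseʳ _) ⟩
        p * 0#                        ≈⟨ zeroʳ p ⟩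
        0#                            ∎
    relation (suc j) = trans (expand (suc j)) (rel j)

  dependent : ∀ d (g : Vector (Vector Carrier d) (suc d)) → NonTrivialRelation g
  dependent zero g = (λ _ → 1#) , (zero , 0≉1 ∘ sym) , λ ()
  dependent (suc d) g with dec (∃[ i ] g i zero ≉ 0#)
  ... | yes (i , p≉0) = eliminate g i p≉0 (dependent d
    (λ l j → g i zero * g (punchIn i l) (suc j) + - g (punchIn i l) zero * g i (suc j)))
  ... | no ¬pivot with c , (i , ci≉0) , rel ← dependent d (λ i j → g (suc i) (suc j)) =
    0# ∷ c , (suc i , ci≉0) , relation
    where
    relation : ∀ j → sum (λ i → (0# ∷ c) i * g i j) ≈ 0#
    relation zero = sum-zero {f = λ i → (0# ∷ c) i * g i zero} (λ i → trans
      (*-congˡ (decidable-stable (dec (g i zero ≈ 0#)) (λ p≉0 → ¬pivot (i , p≉0)))) (zeroʳ _))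
    relation (suc j) = trans (+-congʳ (zeroˡ _)) (trans (+-identityˡ _) (rel j))

  -- n linearly independent vectors and w satisfy a non-trivial relation, in which
  -- w has a non-zero coefficient; pairing the relation with w gives w · w = 0.
  orthogonal-full-dim⇒≈0 : ∀ {n} {X : Pred (Vector Carrier n) 0ℓ} → HasDimension (ℝ^ n) X n →
    ∀ w → (∀ u → X u → dot w u ≈ 0#) → ∀ j → w j ≈ 0#
  orthogonal-full-dim⇒≈0 {n} {X} (p , b , independent , _ , flat⊆hull) w w⊥X =
    dot-self≈0⇒≈0 (x≉0∧xy≈0⇒y≈0 c₀≉0 c₀w²≈0)
    where
    open SetoidReasoning setoid
    ψ = dot-linear w
    -- The functional `dot _ w` vanishes on X, hence on its affine hull, which contains the flat p +
    -- span b. Taking t = 0 isolates p, and cancelling p shows that w is orthogonal to the span of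
    -- b.
    ⊥-flat : ∀ t → dot p w + dot (lincomb (ℝ^ n) t b) w ≈ 0#
    ⊥-flat t with k , c , g , _ , g∈X , x≈ ← flat⊆hull (t , λ _ → refl) =
      trans (sym (+-homo ψ _ _)) (trans (cong ψ x≈)
        (lincomb-zero ψ c g (λ i → trans (dot-comm (g i) w) (w⊥X (g i) (g∈X i)))))
    ⊥-p : dot p w ≈ 0#
    ⊥-p = begin
      dot p w                                        ≈⟨ +-identityʳ _ ⟨
      dot p w + 0#                                   ≈⟨ +-congˡ 0b ⟨
      dot p w + dot (lincomb (ℝ^ n) (λ _ → 0#) b) w  ≈⟨ ⊥-flat (λ _ → 0#) ⟩
      0#                                             ∎
      where
      0b : dot (lincomb (ℝ^ n) (λ _ → 0#) b) w ≈ 0#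
      0b = trans (lincomb-homo ψ (λ _ → 0#) b) (sum-zero (λ i → zeroˡ (dot (b i) w)))
    ⊥-span : ∀ t → dot (lincomb (ℝ^ n) t b) w ≈ 0#
    ⊥-span t = trans (sym (+-identityˡ _)) (trans (+-congʳ (sym ⊥-p)) (⊥-flat t))
    relation : NonTrivialRelation (w ∷ b)
    relation = dependent n (w ∷ b)
    c : Vector Carrier (suc n)
    c = proj₁ relation
    wb≈0 : ∀ j → lincomb (ℝ^ n) c (w ∷ b) j ≈ 0#
    wb≈0 j = trans (lincomb-homo (coordinate-linear j) c (w ∷ b)) (proj₂ (proj₂ relation) j)
    c₀≉0 : c zero ≉ 0#
    c₀≉0 c₀≈0 = proj₂ (proj₁ (proj₂ relation)) (c≈0 (proj₁ (proj₁ (proj₂ relation))))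
      where
      c≈0 : ∀ i → c i ≈ 0#
      c≈0 zero    = c₀≈0
      c≈0 (suc i) = independent (c ∘ suc) (λ j → begin
        lincomb (ℝ^ n) (c ∘ suc) b j                   ≈⟨ +-identityˡ _ ⟨
        0# + lincomb (ℝ^ n) (c ∘ suc) b j              ≈⟨ +-congʳ (trans (*-congʳ c₀≈0) (zeroˡ (w j))) ⟨
        c zero * w j + lincomb (ℝ^ n) (c ∘ suc) b j    ≈⟨ wb≈0 j ⟩
        0#                                             ∎) i
    c₀w²≈0 : c zero * dot w w ≈ 0#
    c₀w²≈0 = begin
      c zero * dot w w                                             ≈⟨ *-homo ψ (c zero) w ⟨
      dot (λ j → c zero * w j) w                                   ≈⟨ +-identityʳ _ ⟨
      dot (λ j → c zero * w j) w + 0#                              ≈⟨ +-congˡ (⊥-span (c ∘ suc)) ⟨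
      dot (λ j → c zero * w j) w + dot (lincomb (ℝ^ n) (c ∘ suc) b) w
        ≈⟨ +-homo ψ (λ j → c zero * w j) (lincomb (ℝ^ n) (c ∘ suc) b) ⟨
      dot (lincomb (ℝ^ n) c (w ∷ b)) w                             ≈⟨ cong ψ wb≈0 ⟩
      dot (λ _ → 0#) w                                             ≈⟨ 0-homo ψ ⟩
      0#                                                           ∎

  -- Support functions of sets closed under non-negative scaling.

  record IsScalable {d : ℕ} (X : Pred (Vector Carrier d) 0ℓ) : Set where
    field
      0-mem     : X (λ _ → 0#)
      *-closed  : ∀ {t x} → 0# ≤ʳ t → X x → X (λ i → t * x i)

  open IsScalable

  -- Treating ℝⁿ as one more scalable set lets the facts about σ below serve both X and ℝⁿ.
  U-scalable : ∀ {d} → IsScalable {d} U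
  U-scalable = _

  pos-scalable : ∀ {d} (S : Pred (Vector Carrier d) 0ℓ) → IsScalable (pos (ℝ^ d) S)
  pos-scalable {d} S = record
    { 0-mem    = 0 , [] , [] , (λ ()) , (λ ()) , λ _ → refl
    ; *-closed = λ { {t} {x} 0≤t (k , c , g , 0≤c , g∈S , x≈) →
        k , (λ i → t * c i) , g , (λ i → *-nonNeg 0≤t (0≤c i)) , g∈S , λ j → begin
          t * x j                                ≈⟨ *-congˡ (x≈ j) ⟩
          t * lincomb (ℝ^ d) c g j               ≈⟨ *-congˡ (lincomb-homo (coordinate-linear j) c g) ⟩
          t * sum (λ i → c i * g i j)            ≈⟨ *-distribˡ-sum t (λ i → c i * g i j) ⟩
          sum (λ i → t * (c i * g i j))          ≈⟨ sum-cong-≋ (λ i → *-assoc t (c i) (g i j)) ⟨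
          sum (λ i → t * c i * g i j)            ≈⟨ lincomb-homo (coordinate-linear j) (λ i → t * c i) g ⟨
          lincomb (ℝ^ d) (λ i → t * c i) g j     ∎ }
    }
    where
    open SetoidReasoning setoid

  module _ {d : ℕ} {X : Pred (Vector Carrier d) 0ℓ} (X-scalable : IsScalable X) where

    -- A positive value could be scaled beyond every bound, contradicting the finite supremum s.
    σ⇒nonPos : ∀ {y s} → σ X y s → ∀ x → X x → dot y x ≤ʳ 0#
    σ⇒nonPos {y} {s} (bound , _) x Xx with total (dot y x) 0#
    ... | inj₁ d≤0 = d≤0
    ... | inj₂ 0≤d with dec (dot y x ≈ 0#)
    ...   | yes d≈0 = ≤-reflexive d≈0
    ...   | no  d≉0 with w , dw≈1 ← inverse (dot y x) d≉0 = ⊥-elim (1≰0 1≤0)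
      where
      open SetoidReasoning setoid
      open Solver
      dot-homo : ∀ t → dot y (λ i → t * x i) ≈ t * dot y x
      dot-homo t = trans (dot-comm y _) (trans (*-homo (dot-linear y) t x) (*-congˡ (dot-comm x y)))
      0≤s : 0# ≤ʳ s
      0≤s = bound 0# ((λ _ → 0#) , 0-mem X-scalable ,
        sym (trans (dot-comm y _) (0-homo (dot-linear y))))
      -- Here w is the inverse of `dot y x`, so y takes the value 1 + s at t x. Since 0 lies in X, s
      -- is non-negative, and hence so is t.
      t = (1# + s) * w
      value : 1# + s ≈ dot y (λ i → t * x i)
      value = begin
        1# + s                       ≈⟨ *-identityʳ _ ⟨
        (1# + s) * 1#                ≈⟨ *-congˡ dw≈1 ⟨
        (1# + s) * (dot y x * w)     ≈⟨ *-congˡ (*-comm _ w) ⟩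
        (1# + s) * (w * dot y x)     ≈⟨ *-assoc _ w _ ⟨
        t * dot y x                  ≈⟨ dot-homo t ⟨
        dot y (λ i → t * x i)        ∎
      1+s≤s : 1# + s ≤ʳ s
      1+s≤s = bound (1# + s) (_ , *-closed X-scalable
        (*-nonNeg (+-nonNeg 0≤1 0≤s) (inverse-nonNeg 0≤d dw≈1)) Xx , value)
      1≤0 : 1# ≤ʳ 0#
      1≤0 = ≲-respʳ-≈ (-‿inverseʳ s) (≲-respˡ-≈
        (trans (+-assoc 1# s (- s)) (trans (+-congˡ (-‿inverseʳ s)) (+-identityʳ 1#)))
        (+-monoˡ-≤ (- s) 1+s≤s))

    -- The bound 0 is attained at the origin. The value is any s with `s ≈ 0#`, since equality in
    -- the field is a setoid relation.
    nonPos⇒σ : ∀ {y s} → (∀ x → X x → dot y x ≤ʳ 0#) → s ≈ 0# → σ X y s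
    nonPos⇒σ {y} nonPos s≈0 =
      (λ { r (x , Xx , r≈) → ≲-respʳ-≈ (sym s≈0) (≲-respˡ-≈ (sym r≈) (nonPos x Xx)) }) ,
      (λ b bound → ≲-respˡ-≈ (sym s≈0) (bound 0# ((λ _ → 0#) , 0-mem X-scalable ,
        sym (trans (dot-comm y _) (0-homo (dot-linear y))))))

    -- By `σ⇒nonPos` and `nonPos⇒σ`, 0 is a supremum of the same set, and suprema are unique.
    σ⇒≈0 : ∀ {y s} → σ X y s → s ≈ 0#
    σ⇒≈0 σs = antisym
      (proj₂ σs 0# (proj₁ (nonPos⇒σ (σ⇒nonPos σs) refl)))
      (proj₂ (nonPos⇒σ (σ⇒nonPos σs) refl) _ (proj₁ σs))

  -- The kernel of A and the support function at -Aν.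

  module _ {n m : ℕ} (A : Vector (Vector Carrier n) m) where

    open LeftModule (ℝ^ n) using () renaming (-ᴹ_ to -ⁿ_)

    Kernel : Pred (Vector Carrier m) 0ℓ
    Kernel ν = ∀ j → (A · ν) j ≈ 0#

    pairing : Vector Carrier n → Vector Carrier m → Carrier
    pairing u ν = dot (A · ν) u

    pairing-linear : ∀ u → IsLinear (ℝ^ m) (pairing u)
    pairing-linear u = record
      { cong   = λ {x} {y} x≈y → trans (as-dot x) (trans (cong L x≈y) (sym (as-dot y)))
      ; +-homo = λ x y → trans (as-dot _) (trans (+-homo L x y) (sym (+-cong (as-dot x) (as-dot y))))
      ; *-homo = λ t x → trans (as-dot _) (trans (*-homo L t x) (*-congˡ (sym (as-dot x))))
      }
      where
      -- The transpose of A applied to u: moving A across the dot product makes linearity in ν that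
      -- of `dot-linear`.
      w : Vector Carrier m
      w α = dot (A α) u
      L : IsLinear (ℝ^ m) (λ ν → dot ν w)
      L = dot-linear w
      as-dot : ∀ ν → pairing u ν ≈ dot ν w
      as-dot ν = lincomb-homo (dot-linear u) ν A

    kernel⇒pairing≈0 : ∀ {ν} → Kernel ν → ∀ u → pairing u ν ≈ 0#
    kernel⇒pairing≈0 Aν≈0 u = trans (cong (dot-linear u) Aν≈0) (0-homo (dot-linear u))

    kernel⇒σ : ∀ {X} → IsScalable X → ∀ {ν s} → Kernel ν → s ≈ 0# → σ X (-ⁿ (A · ν)) s
    kernel⇒σ X-scalable {ν} Aν≈0 = nonPos⇒σ X-scalable (λ x _ → ≤-reflexive (trans
      (-‿homo (dot-linear x) (A · ν)) (trans (-‿cong (kernel⇒pairing≈0 Aν≈0 x)) -0#≈0#)))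

    -- With all of ℝⁿ available, -Aν may be paired with itself: its squared norm is then at most 0.
    σU⇒kernel : ∀ {ν s} → σ U (-ⁿ (A · ν)) s → Kernel ν
    σU⇒kernel {ν} σs j = trans (sym (-‿involutive _)) (trans (-‿cong (dot-self≈0⇒≈0 sq≈0 j)) -0#≈0#)
      where
      sq≈0 : dot (-ⁿ (A · ν)) (-ⁿ (A · ν)) ≈ 0#
      sq≈0 = antisym (σ⇒nonPos U-scalable σs _ _) (dot-self-nonNeg (-ⁿ (A · ν)))

    -- Comparison of X-circuits with ℝⁿ-circuits.

    module _ {X : Pred (Vector Carrier n) 0ℓ} (X-scalable : IsScalable X)
             (X-spanning : ∀ w → (∀ u → X u → dot w u ≈ 0#) → ∀ j → w j ≈ 0#) where

      -- The preimage under A of the dual cone X*. If w and -w both lie in X*, then w is orthogonal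
      -- to X; thus `X-spanning` expresses that X* is pointed.
      Dual : Pred (Vector Carrier m) 0ℓ
      Dual ν = ∀ u → X u → 0# ≤ʳ pairing u ν

      σ⇒dual : ∀ {ν s} → σ X (-ⁿ (A · ν)) s → Dual ν
      σ⇒dual {ν} σs u Xu = ≲-respʳ-≈
        (trans (-‿cong (-‿homo (dot-linear u) (A · ν))) (-‿involutive _))
        (x≤0⇒0≤-x (σ⇒nonPos X-scalable σs u Xu))

      σU⇒σ : ∀ {ν s} → σ U (-ⁿ (A · ν)) s → σ X (-ⁿ (A · ν)) s
      σU⇒σ σs = kernel⇒σ X-scalable (σU⇒kernel σs) (σ⇒≈0 U-scalable σs)

      σ⇒σU : ∀ {ν s} → Kernel ν → σ X (-ⁿ (A · ν)) s → σ U (-ⁿ (A · ν)) s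
      σ⇒σU Aν≈0 σs = kernel⇒σ U-scalable Aν≈0 (σ⇒≈0 X-scalable σs)

      -- Where σ for ℝⁿ agrees with a linear f, so does σ for X by `σU⇒σ`. Every cone that could
      -- disqualify ν over ℝⁿ is therefore already ruled out over X.
      circuit⇒circuitU : ∀ {β ν} → Kernel ν → IsCircuit X A β ν → IsCircuit U A β ν
      circuit⇒circuitU Aν≈0 circuit = record
        { nonzero    = nonzero
        ; mem-N      = mem-N
        ; finite     = proj₁ finite , σ⇒σU Aν≈0 (proj₂ finite)
        ; not-relint = λ { C cone dim C⊆N (f , f-linear , σf) →
            not-relint C cone dim C⊆N (f , f-linear , λ ν Cν → σU⇒σ (σf ν Cν)) }
        }
        where
        open IsCircuit circuit

      -- If ν is a relative interior point of C and y ∈ C, then C also contains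
      -- ν + t (ν − y) for some t > 0.  Since Aν = 0, this point is in Dual only
      -- if A y vanishes on X.
      relint-kernel : {C : Pred (Vector Carrier m) 0ℓ} → C ⊆ Dual → ∀ {ν} → Kernel ν →
        relativeInterior C ν → C ⊆ Kernel
      relint-kernel {C} C⊆Dual {ν} Aν≈0 (Cν , ε , 0<ε , ball) {y} Cy =
        X-spanning (A · y) (λ u Xu → x≉0∧xy≈0⇒y≈0 (0<x⇒x≉0 0<t)
          (antisym (≲-respˡ-≈ (-‿involutive _) (0≤x⇒-x≤0 (≲-respʳ-≈ (pairing-z u) (C⊆Dual Cz u Xu))))
                   (*-nonNeg (proj₁ 0<t) (C⊆Dual Cy u Xu))))
        where
        open SetoidReasoning setoid
        open Solver
        d : Vector Carrier m
        d i = ν i - y i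
        -- The new point z satisfies z - ν = t d, so this bounds its squared distance from ν, the
        -- quantity that `Ball` compares with ε².
        scale : ∃[ t ] 0# < t × t * t * dot d d < ε * ε
        scale = small-scale 0<ε (dot-self-nonNeg d)
        t : Carrier
        t = proj₁ scale
        0<t : 0# < t
        0<t = proj₁ (proj₂ scale)
        coeffs : Vector Carrier 2
        coeffs = (1# + t) ∷ - t ∷ []
        points : Vector (Vector Carrier m) 2
        points = ν ∷ y ∷ []
        z : Vector Carrier m
        z = lincomb (ℝ^ m) coeffs points
        points∈C : ∀ i → C (points i)
        points∈C zero       = Cν
        points∈C (suc zero) = Cy
        coeffs-sum : sum coeffs ≈ 1#
        coeffs-sum = begin
          1# + t + (- t + 0#) ≈⟨ +-congˡ (+-identityʳ _) ⟩
          1# + t - t          ≈⟨ +-assoc _ _ _ ⟩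
          1# + (t - t)        ≈⟨ +-congˡ (-‿inverseʳ t) ⟩
          1# + 0#             ≈⟨ +-identityʳ _ ⟩
          1#                  ∎
        z-ν : ∀ i → z i - ν i ≈ t * d i
        z-ν i = begin
          (1# + t) * ν i + (- t * y i + 0#) - ν i
            ≈⟨ solve 5 (λ t a s y b → (con 1 :+ t) :* a :+ (s :* y :+ con 0) :+ b :=
                 (a :+ b) :+ (t :* a :+ s :* y)) refl t (ν i) (- t) (y i) (- ν i) ⟩
          (ν i - ν i) + (t * ν i + - t * y i)
            ≈⟨ +-cong (-‿inverseʳ _) (+-congˡ (trans (sym (-‿distribˡ-* t _)) (-‿distribʳ-* t _))) ⟩
          0# + (t * ν i + t * - y i)
            ≈⟨ +-identityˡ _ ⟩
          t * ν i + t * - y i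
            ≈⟨ distribˡ t _ _ ⟨
          t * d i ∎
        dist-z : dot (λ i → z i - ν i) (λ i → z i - ν i) ≈ t * t * dot d d
        dist-z = begin
          dot (λ i → z i - ν i) (λ i → z i - ν i)
            ≈⟨ sum-cong-≋ (λ i → trans (*-cong (z-ν i) (z-ν i))
                 (solve 2 (λ t x → t :* x :* (t :* x) := t :* t :* (x :* x)) refl t (d i))) ⟩
          sum (λ i → t * t * (d i * d i))
            ≈⟨ *-distribˡ-sum (t * t) (λ i → d i * d i) ⟨
          t * t * dot d d ∎
        Cz : C z
        Cz = ball z (2 , coeffs , points , coeffs-sum , points∈C , λ _ → refl)
          ( ≲-respˡ-≈ (sym dist-z) (proj₁ (proj₂ (proj₂ scale)))
          , (λ e → proj₂ (proj₂ (proj₂ scale)) (trans (sym dist-z) e)))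
        pairing-z : ∀ u → pairing u z ≈ - (t * pairing u y)
        pairing-z u = begin
          pairing u z
            ≈⟨ lincomb-homo (pairing-linear u) coeffs points ⟩
          (1# + t) * pairing u ν + (- t * pairing u y + 0#)
            ≈⟨ +-cong (trans (*-congˡ (kernel⇒pairing≈0 Aν≈0 u)) (zeroʳ _)) (+-identityʳ _) ⟩
          0# + - t * pairing u y
            ≈⟨ +-identityˡ _ ⟩
          - t * pairing u y
            ≈⟨ -‿distribˡ-* t _ ⟨
          - (t * pairing u y) ∎

      circuitU⇒kernel : ∀ {β ν} → IsCircuit U A β ν → Kernel ν
      circuitU⇒kernel circuit = σU⇒kernel (proj₂ (IsCircuit.finite circuit))

      -- A cone on which σ for X is linear lies in `Dual`. If it had ν in its relative interior,
      -- `relint-kernel` would put all of it in the kernel, where σ for ℝⁿ agrees with the same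
      -- linear function, contradicting that ν is an ℝⁿ-circuit.
      circuitU⇒circuit : ∀ {β ν} → IsCircuit U A β ν → IsCircuit X A β ν
      circuitU⇒circuit {ν = ν} circuit = record
        { nonzero    = nonzero
        ; mem-N      = mem-N
        ; finite     = proj₁ finite , σU⇒σ (proj₂ finite)
        ; not-relint = λ { C cone dim C⊆N (f , f-linear , σf) relint →
            let C⊆Kernel = relint-kernel {C} (λ {y} Cy → σ⇒dual (σf y Cy)) (circuitU⇒kernel circuit) relint
            in not-relint C cone dim C⊆N
                 (f , f-linear , λ y Cy → σ⇒σU (C⊆Kernel Cy) (σf y Cy)) relint }
        }
        where
        open IsCircuit circuit

      Λ⇒ΛU : ∀ {ν} → Kernel ν → Λ X A ν → Λ U A ν
      Λ⇒ΛU Aν≈0 (β , circuit , νβ) = β , circuit⇒circuitU Aν≈0 circuit , νβ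

      ΛU⇒Λ : ∀ {ν} → Λ U A ν → Λ X A ν
      ΛU⇒Λ (β , circuit , νβ) = β , circuitU⇒circuit circuit , νβ

      ΛU⇒kernel : ∀ {ν} → Λ U A ν → Kernel ν
      ΛU⇒kernel (_ , circuit , _) = circuitU⇒kernel circuit

      -- Comparison of the two circuit graphs.

      private
        𝔼 : LeftModule ring 0ℓ 0ℓ
        𝔼 = ℝ^𝒜×ℝ X A

      open LeftModule 𝔼 using (_≈ᴹ_; *ₗ-zeroˡ; ≈ᴹ-refl; ≈ᴹ-sym; ≈ᴹ-trans; *ₗ-congʳ)
        renaming (Carrierᴹ to Extended; _*ₗ_ to _*ᴱ_; _+ᴹ_ to _+ᴱ_)

      -- The set whose conic hull is `circuitGraph Y A`, named so that the cases of X and ℝⁿ can be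
      -- compared generator by generator inside the common space `𝔼`.
      Generator : Pred (Vector Carrier n) 0ℓ → Pred Extended (ℓsuc 0ℓ)
      Generator Y = (λ (ν , s) → Λ Y A ν × σ Y (-ⁿ (A · ν)) s) ∪ (λ p → p ≈ᴹ ((λ _ → 0#) , 1#))

      extended-pairing-linear : ∀ u → IsLinear 𝔼 (λ p → pairing u (proj₁ p))
      extended-pairing-linear u = record
        { cong   = λ p≈q → cong (pairing-linear u) (proj₁ p≈q)
        ; +-homo = λ p q → +-homo (pairing-linear u) (proj₁ p) (proj₁ q)
        ; *-homo = λ t p → *-homo (pairing-linear u) t (proj₁ p)
        }

      generator-dual : ∀ {p} → Generator X p → Dual (proj₁ p)
      generator-dual     (inj₁ (_ , σs)) = σ⇒dual σs
      generator-dual {p} (inj₂ p≈e) u _ = ≤-reflexive (sym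
        (trans (cong (pairing-linear u) {proj₁ p} (proj₁ p≈e)) (0-homo (pairing-linear u))))

      -- For each u in X, the pairing with u is a linear functional that is non-negative on the
      -- generators, hence on their conic hull.
      graph-dual : ∀ {p} → circuitGraph X A p → Dual (proj₁ p)
      graph-dual (k , c , g , 0≤c , g∈ , p≈) u Xu = ≲-respʳ-≈
        (sym (trans (cong (extended-pairing-linear u) p≈) (lincomb-homo (extended-pairing-linear u) c g)))
        (sum-nonNeg (λ i → *-nonNeg (0≤c i) (generator-dual (g∈ i) u Xu)))

      graphU⇒graph : circuitGraph U A ⊆ circuitGraph X A
      graphU⇒graph (k , c , g , 0≤c , g∈ , p≈) = k , c , g , 0≤c , (λ i → lift-generator (g∈ i)) , p≈
        where
        lift-generator : Generator U ⊆ Generator X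
        lift-generator (inj₁ (λν , σs)) = inj₁ (ΛU⇒Λ λν , σU⇒σ σs)
        lift-generator (inj₂ p≈e)       = inj₂ p≈e

      -- Generators outside the kernel have coefficient 0 and are replaced by (0 , 1).
      graph⇒graphU : ∀ {p} → Kernel (proj₁ p) → circuitGraph X A p → circuitGraph U A p
      graph⇒graphU {p} Ap≈0 (k , c , g , 0≤c , g∈ , p≈) =
        k , c , (λ i → proj₁ (replace i)) , 0≤c , (λ i → proj₁ (proj₂ (replace i))) ,
        ≈ᴹ-trans p≈ (lincomb-cong 𝔼 (λ i → proj₂ (proj₂ (replace i))))
        where
        -- These terms are non-negative and sum to the pairing of u with p, which is 0 because p is
        -- in the kernel.
        terms≈0 : ∀ u → X u → ∀ i → c i * pairing u (proj₁ (g i)) ≈ 0#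
        terms≈0 u Xu = sum-≈0⇒≈0 (λ i → *-nonNeg (0≤c i) (generator-dual (g∈ i) u Xu))
          (trans (sym (lincomb-homo (extended-pairing-linear u) c g))
            (trans (sym (cong (extended-pairing-linear u) p≈)) (kernel⇒pairing≈0 Ap≈0 u)))
        restrict : ∀ {q} → Kernel (proj₁ q) → Generator X q → Generator U q
        restrict Aq≈0 (inj₁ (λq , σs)) = inj₁ (Λ⇒ΛU Aq≈0 λq , σ⇒σU Aq≈0 σs)
        restrict Aq≈0 (inj₂ q≈e)       = inj₂ q≈e
        -- The split is on the coefficient. If it is non-zero, `terms≈0` and `X-spanning` put the
        -- generator in the kernel, so it is one for ℝⁿ as well; if it is zero, the term vanishes
        -- for any generator.
        replace : ∀ i → Σ[ h ∈ Extended ] Generator U h × (c i *ᴱ g i ≈ᴹ c i *ᴱ h)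
        replace i with dec (c i ≈ 0#)
        ... | no ci≉0 = g i , restrict (X-spanning (A · proj₁ (g i))
                          (λ u Xu → x≉0∧xy≈0⇒y≈0 ci≉0 (terms≈0 u Xu i))) (g∈ i) , ≈ᴹ-refl
        ... | yes ci≈0 = e , inj₂ ≈ᴹ-refl ,
          ≈ᴹ-trans (vanish (g i)) (≈ᴹ-sym (vanish e))
          where
          e : Extended
          e = (λ _ → 0#) , 1#
          vanish : ∀ q → c i *ᴱ q ≈ᴹ ((λ _ → 0#) , 0#)
          vanish q = ≈ᴹ-trans (*ₗ-congʳ ci≈0) (*ₗ-zeroˡ q)

      -- Extreme rays of the two circuit graphs.

      ray-kernel : ∀ {ν s} → Kernel ν → ∀ {p} → Ray 𝔼 (ν , s) p → ∀ u → pairing u (proj₁ p) ≈ 0#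
      ray-kernel {ν} {s} Aν≈0 (r , _ , p≈) u = trans (cong (extended-pairing-linear u) p≈)
        (trans (*-homo (extended-pairing-linear u) r (ν , s))
          (trans (*-congˡ (kernel⇒pairing≈0 Aν≈0 u)) (zeroʳ r)))

      -- This is the face property of the kernel. Two non-negative pairings with positive weights
      -- add up to 0 only if both are 0, and `X-spanning` passes from all u in X to the kernel.
      segment-kernel : ∀ {p q t} → Dual (proj₁ p) → Dual (proj₁ q) → 0# < t → t < 1# →
        (∀ u → pairing u (proj₁ (t *ᴱ p +ᴱ (1# - t) *ᴱ q)) ≈ 0#) →
        Kernel (proj₁ p) × Kernel (proj₁ q)
      segment-kernel {p} {q} {t} dual-p dual-q 0<t t<1 mid≈0 =
        X-spanning (A · proj₁ p) (λ u Xu → x≉0∧xy≈0⇒y≈0 (0<x⇒x≉0 0<t)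
          (+-≈0⇒≈0 (0≤tp u Xu) (0≤t′q u Xu) (combination u))) ,
        X-spanning (A · proj₁ q) (λ u Xu → x≉0∧xy≈0⇒y≈0 t′≉0
          (+-≈0⇒≈0ʳ (0≤tp u Xu) (0≤t′q u Xu) (combination u)))
        where
        t′ : Carrier
        t′ = 1# - t
        0≤t′ : 0# ≤ʳ t′
        0≤t′ = ≲-respˡ-≈ (-‿inverseʳ t) (+-monoˡ-≤ (- t) (proj₁ t<1))
        t′≉0 : t′ ≉ 0#
        t′≉0 t′≈0 = proj₂ t<1 (sym (x-y≈0⇒x≈y 1# t t′≈0))
        0≤tp : ∀ u → X u → 0# ≤ʳ t * pairing u (proj₁ p)
        0≤tp u Xu = *-nonNeg (proj₁ 0<t) (dual-p u Xu)
        0≤t′q : ∀ u → X u → 0# ≤ʳ t′ * pairing u (proj₁ q)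
        0≤t′q u Xu = *-nonNeg 0≤t′ (dual-q u Xu)
        combination : ∀ u → t * pairing u (proj₁ p) + t′ * pairing u (proj₁ q) ≈ 0#
        combination u = trans (sym (trans (+-homo L (t *ᴱ p) (t′ *ᴱ q))
          (+-cong (*-homo L t p) (*-homo L t′ q)))) (mid≈0 u)
          where L = extended-pairing-linear u

      -- Extremality passes to the smaller graph because its segments are segments of the larger
      -- one. The ray itself stays in the smaller graph because it lies in the kernel.
      reduced⇒reducedU : ∀ {ν} → Kernel ν → IsReduced X A ν → IsReduced U A ν
      reduced⇒reducedU {ν} Aν≈0 (s , σs , ≉0 , face) = s , σ⇒σU Aν≈0 σs , ≉0 , record
        { convex   = convex
        ; subset   = λ {p} ray → graph⇒graphU
            (X-spanning (A · proj₁ p) (λ u _ → ray-kernel Aν≈0 ray u)) (subset ray)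
        ; extremal = λ p∈G q∈G → extremal (graphU⇒graph p∈G) (graphU⇒graph q∈G)
        }
        where
        open IsFace face

      -- A segment of the larger graph that meets the ray in an interior point has both endpoints in
      -- the kernel, hence in the smaller graph, where extremality is given.
      reducedU⇒reduced : ∀ {ν} → IsReduced U A ν → IsReduced X A ν
      reducedU⇒reduced {ν} (s , σs , ≉0 , face) = s , σU⇒σ σs , ≉0 , record
        { convex   = convex
        ; subset   = λ ray → graphU⇒graph (subset ray)
        ; extremal = λ {p} {q} {t} p∈G q∈G 0<t t<1 ray →
            let Ap≈0 , Aq≈0 = segment-kernel {p} {q} (graph-dual p∈G) (graph-dual q∈G) 0<t t<1
                                (ray-kernel (σU⇒kernel σs) ray)
            in extremal (graph⇒graphU Ap≈0 p∈G) (graph⇒graphU Aq≈0 q∈G) 0<t t<1 ray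
        }
        where
        open IsFace face

      Λ⋆-kernel : (Λ⋆ X A ∩ Kernel) ≐ Λ⋆ U A
      Λ⋆-kernel =
        (λ ((λν , reduced) , Aν≈0) → Λ⇒ΛU Aν≈0 λν , reduced⇒reducedU Aν≈0 reduced) ,
        (λ (λν , reduced) → (ΛU⇒Λ λν , reducedU⇒reduced reduced) , ΛU⇒kernel λν)

theorem6p4 : ExcludedMiddle (ℓsuc 0ℓ) → (ℝ : CompleteOrderedField) →
    let open SublinearCircuits ℝ in
    (n m k : ℕ) → NonZero m → n ≤ k →
    let open LeftModule (ℝ^ n) in
    (A : Vector Carrierᴹ m) → Injective _≡_ _≈ᴹ_ A →
    (v : Vector Carrierᴹ k) →
    let X = pos (ℝ^ n) (Range (ℝ^ n) v) in
    HasDimension (ℝ^ n) X n →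
    (Λ⋆ X A ∩ (λ ν → A · ν ≈ᴹ 0ᴹ)) ≐ Λ⋆ U A
theorem6p4 em ℝ n m k _ _ A _ v X-full-dim =
  Λ⋆-kernel A (pos-scalable (Range (ℝ^ n) v)) (orthogonal-full-dim⇒≈0 X-full-dim)
  where
  open SublinearCircuits ℝ
  open ConeCircuits em ℝ
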